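{- Let $p$ be an odd prime with $p\neq 5$, and let $B$ be a non-empty subset of $\mathbb Z_p$. Then $E_{Q_p,B}=p+2$.
   Context: For an odd prime $p$, $\mathbb Z_p=\mathbb Z/p\mathbb Z$, $U(p)$ is its group of units, and $Q_p=\{x^2:x\in U(p)\}$. A sequence of length $k$ in $\mathbb Z_p$ is an element of $\mathbb Z_p^k$. For a non-empty $B\subseteq\mathbb Z_p$, a sequence $(x_1,\ldots,x_k)$ in $\mathbb Z_p$ is called a $(Q_p,B)$-weighted zero-sum sequence if there exist $a_1,\ldots,a_k\in Q_p$ and $b_1,\ldots,b_k\in B$ such that $a_1x_1+\cdots+a_kx_k=0$ and $b_1a_1+\cdots+b_ka_k=0$ in $\mathbb Z_p$. The constant $E_{Q_p,B}$ is the least positive integer $k$ such that every sequence in $\mathbb Z_p$ of length $k$ has a $(Q_p,B)$-weighted zero-sum subsequence of length $p$ (terms not necessarily consecutive). -}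

module Defs where

open import Algebra.Definitions using (Invertible)
open import Data.Fin.Base using (Fin; toℕ)
open import Data.Fin.Subset using (Subset; _∈_)
open import Data.List.Relation.Binary.Sublist.Propositional using (_⊆_)
open import Data.Nat.Base using (ℕ; NonZero; _+_; _*_; _≤_; _<_)
open import Data.Nat.DivMod using (_mod_)
open import Data.Product.Base using (∃-syntax; _×_)
open import Data.Vec.Base using (Vec; foldr′; zipWith; toList)
open import Data.Vec.Relation.Unary.All using (All)
open import Level using (0ℓ)
open import Relation.Binary.PropositionalEquality.Core using (_≡_)
open import Relation.Unary using (Pred)

-- ℤ/pℤ is modelled by the canonical residues Fin p = {0, …, p-1}, with
-- arithmetic modulo p; propositional equality is then equality in ℤ/pℤ.
module _ (p : ℕ) .{{_ : NonZero p}} where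

  0ₚ 1ₚ : Fin p
  0ₚ = 0 mod p
  1ₚ = 1 mod p

  addₚ mulₚ : Fin p → Fin p → Fin p
  addₚ x y = (toℕ x + toℕ y) mod p
  mulₚ x y = (toℕ x * toℕ y) mod p

  dotₚ : ∀ {k} → Vec (Fin p) k → Vec (Fin p) k → Fin p
  dotₚ xs ys = foldr′ addₚ 0ₚ (zipWith mulₚ xs ys)

  U : Pred (Fin p) 0ℓ
  U = Invertible _≡_ 1ₚ mulₚ

  Q : Pred (Fin p) 0ℓ
  Q y = ∃[ x ] U x × y ≡ mulₚ x x

  WeightedZeroSum : Subset p → ∀ {k} → Pred (Vec (Fin p) k) 0ℓ
  WeightedZeroSum B {k} xs =
    ∃[ as ] ∃[ bs ] All Q {n = k} as × All (_∈ B) {n = k} bs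
                  × dotₚ as xs ≡ 0ₚ × dotₚ bs as ≡ 0ₚ

  EverySequenceHasZeroSumSubsequence : Subset p → Pred ℕ 0ℓ
  EverySequenceHasZeroSumSubsequence B k = (xs : Vec (Fin p) k) →
    ∃[ ys ] toList {n = p} ys ⊆ toList xs × WeightedZeroSum B ys

  -- "E_{Q,B} = n".  The constant is given by its graph: being a least
  -- element determines n uniquely, and asserting it for a particular n
  -- includes the existence of the constant.
  E≡ : Subset p → Pred ℕ 0ℓ
  E≡ B n =
    0 < n × EverySequenceHasZeroSumSubsequence B n
          × (∀ k → 0 < k → EverySequenceHasZeroSumSubsequence B k → n ≤ k)

{-# OPTIONS --safe #-}
-- Upper bound.  Taking all bⱼ equal, both conditions follow from Σ aᵢ = 0 = Σ aᵢ xᵢ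
-- with p weights aᵢ in Q.  Among p + 2 residues there are either three equal terms
-- or two pairs u, u, v, v and a term w different from u and v.  For p ≥ 7 every
-- nonzero element is in Q + Q and every element is in Q x + Q y + Q z for nonzero
-- x, y, z.  The other terms get arbitrary weights, and the equations then determine
-- the total weight of u and v, which is nonzero if w is weighted suitably; or the
-- weights of three terms different from u, and then the total weight of the terms u.
-- If there are no three terms different from the triple u, then p terms are equal.
--
-- Lower bound.  With r a nonresidue, the sequence 1, -r, 0, …, 0 of length p + 1 is
-- a counterexample, since any p of its terms include 1 or -r.
module Submission where

open import Defs
open import Data.Fin.Subset using (Subset; Nonempty)
open import Data.Nat.Base using (ℕ; NonZero; _+_)
open import Data.Nat.Divisibility using (_∤_)
open import Data.Nat.Primality using (Prime)
open import Relation.Binary.PropositionalEquality using (_≢_)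

open import Algebra.Bundles using (CommutativeSemiring)
open import Algebra.Structures using (IsCommutativeMonoid)
open import Algebra.Structures.Biased using (isCommutativeSemiringˡ)
import Algebra.Solver.Ring.NaturalCoefficients.Default as SemiringSolver
open import Data.Fin.Base using (Fin; zero; suc; toℕ; remQuot; combine)
open import Data.Fin.Properties using (_≟_; all?; any?; toℕ<n; toℕ-fromℕ<; toℕ-injective; pigeonhole; combine-remQuot; ¬∀⟶∃¬)
open import Data.Fin.Subset using () renaming (_∈_ to _∈ˢ_)
open import Data.List.Base using (List; []; _∷_; _++_; length; replicate; lookup)
open import Data.List.Membership.Propositional using (_∈_)
open import Data.List.Membership.Propositional.Properties using (∈-∃++; ∈-lookup)
import Data.List.Properties as List
open import Data.List.Relation.Binary.Permutation.Propositional using (_↭_; module _↭_; refl; prep; swap; ↭-sym; ↭-trans)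
open import Data.List.Relation.Binary.Permutation.Propositional.Properties using (shift; shifts; ↭-length; ∈-resp-↭)
open import Data.List.Relation.Binary.Sublist.Propositional using (_⊆_; []; _∷_; _∷ʳ_; minimum; ⊆-trans)
open import Data.List.Relation.Binary.Sublist.Propositional.Properties using (length-mono-≤)
open import Data.List.Relation.Unary.All as List using ([]; _∷_)
open import Data.List.Relation.Unary.Any using (here; there)
open import Data.Nat.Base as ℕ using (zero; suc; _*_; _∸_; _<_; _≤_; z≤n; s≤s; z<s)
open import Data.Nat.Coprimality using (coprime-Bézout; prime⇒coprime)
open import Data.Nat.Divisibility using (_∣_; m%n≡0⇒n∣m; ∣⇒≤; n∣m⇒m%n≡0; n∣m*n; ∣-refl; divides)
open import Data.Nat.DivMod using (_/_; _%_; _mod_; m%n<n; m≡m%n+[m/n]*n; %-distribˡ-+; %-distribˡ-*; m<n⇒m%n≡m)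
open import Data.Nat.GCD using (module Bézout)
open import Data.Nat.Primality using (prime⇒nonTrivial; ¬prime[0]; ¬prime[1])
import Data.Nat.Properties as ℕ
open import Data.Product.Base using (∃-syntax; ∃₂; _×_; _,_; proj₁; proj₂; uncurry)
open import Data.Sum.Base using (_⊎_; inj₁; inj₂)
open import Data.Vec.Base as Vec using (Vec; []; _∷_; toList)
open import Data.Vec.Properties using (length-toList)
open import Data.Vec.Relation.Unary.All as Vec using ([]; _∷_)
open import Function.Base using (_∘_)
open import Level using (0ℓ)
open import Relation.Binary.PropositionalEquality using (_≡_; refl; sym; trans; cong; cong₂; subst; subst₂; isEquivalence; module ≡-Reasoning)
open import Relation.Nullary using (¬_; contradiction; yes; no; Dec; _×-dec_; _⊎-dec_)
open import Relation.Nullary.Decidable using (from-yes; _→-dec_; ¬?)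

-- Arithmetic modulo p as a commutative semiring

module Residues (p : ℕ) .{{_ : NonZero p}} where

  infixl 6 _+ₚ_
  infixl 7 _*ₚ_

  _+ₚ_ _*ₚ_ : Fin p → Fin p → Fin p
  _+ₚ_ = addₚ p
  _*ₚ_ = mulₚ p

  0# 1# : Fin p
  0# = 0ₚ p
  1# = 1ₚ p

  [_] : ℕ → Fin p
  [ n ] = n mod p

  -ₚ_ : Fin p → Fin p
  -ₚ x = [ p ∸ toℕ x ]

  toℕ-[] : ∀ n → toℕ [ n ] ≡ n % p
  toℕ-[] n = toℕ-fromℕ< _

  []-cong-% : ∀ {m n} → m % p ≡ n % p → [ m ] ≡ [ n ]
  []-cong-% {m} {n} eq = toℕ-injective (trans (toℕ-[] m) (trans eq (sym (toℕ-[] n))))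

  []-toℕ : ∀ x → [ toℕ x ] ≡ x
  []-toℕ x = toℕ-injective (trans (toℕ-[] (toℕ x)) (m<n⇒m%n≡m (toℕ<n x)))

  []-+ : ∀ m n → [ m + n ] ≡ [ m ] +ₚ [ n ]
  []-+ m n rewrite toℕ-[] m | toℕ-[] n = []-cong-% (%-distribˡ-+ m n p)

  []-* : ∀ m n → [ m * n ] ≡ [ m ] *ₚ [ n ]
  []-* m n rewrite toℕ-[] m | toℕ-[] n = []-cong-% (%-distribˡ-* m n p)

  p∣⇒[]≡0 : ∀ {n} → p ∣ n → [ n ] ≡ 0#
  p∣⇒[]≡0 {n} p∣n = []-cong-% (trans (n∣m⇒m%n≡0 n p p∣n) (sym (m<n⇒m%n≡m (ℕ.>-nonZero⁻¹ p))))

  []≡0⇒p∣ : ∀ {n} → [ n ] ≡ 0# → p ∣ n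
  []≡0⇒p∣ {n} eq = m%n≡0⇒n∣m n p (begin
    n % p     ≡⟨ toℕ-[] n ⟨
    toℕ [ n ] ≡⟨ cong toℕ eq ⟩
    toℕ [ 0 ] ≡⟨ toℕ-[] 0 ⟩
    0 % p     ≡⟨ m<n⇒m%n≡m (ℕ.>-nonZero⁻¹ p) ⟩
    0         ∎)
    where open ≡-Reasoning

  -- This and `*-[]ˡ` turn a nested expression into a single reduction of a natural number, so that
  -- the laws below come from those of ℕ.
  +-[]ˡ : ∀ m z → [ m ] +ₚ z ≡ [ m + toℕ z ]
  +-[]ˡ m z = trans (cong ([ m ] +ₚ_) (sym ([]-toℕ z))) (sym ([]-+ m (toℕ z)))

  *-[]ˡ : ∀ m z → [ m ] *ₚ z ≡ [ m * toℕ z ]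
  *-[]ˡ m z = trans (cong ([ m ] *ₚ_) (sym ([]-toℕ z))) (sym ([]-* m (toℕ z)))

  +ₚ-comm : ∀ x y → x +ₚ y ≡ y +ₚ x
  +ₚ-comm x y = cong [_] (ℕ.+-comm (toℕ x) (toℕ y))

  *ₚ-comm : ∀ x y → x *ₚ y ≡ y *ₚ x
  *ₚ-comm x y = cong [_] (ℕ.*-comm (toℕ x) (toℕ y))

  +ₚ-assoc : ∀ x y z → (x +ₚ y) +ₚ z ≡ x +ₚ (y +ₚ z)
  +ₚ-assoc x y z = begin
    (x +ₚ y) +ₚ z                 ≡⟨ +-[]ˡ (toℕ x + toℕ y) z ⟩
    [ toℕ x + toℕ y + toℕ z ]     ≡⟨ cong [_] (ℕ.+-assoc (toℕ x) (toℕ y) (toℕ z)) ⟩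
    -- `+-[]ˡ` absorbs a reduced operand on the left only, so y + z is moved there.
    [ toℕ x + (toℕ y + toℕ z) ]   ≡⟨ cong [_] (ℕ.+-comm (toℕ x) (toℕ y + toℕ z)) ⟩
    [ toℕ y + toℕ z + toℕ x ]     ≡⟨ +-[]ˡ (toℕ y + toℕ z) x ⟨
    (y +ₚ z) +ₚ x                 ≡⟨ +ₚ-comm (y +ₚ z) x ⟩
    x +ₚ (y +ₚ z)                 ∎
    where open ≡-Reasoning

  *ₚ-assoc : ∀ x y z → (x *ₚ y) *ₚ z ≡ x *ₚ (y *ₚ z)
  *ₚ-assoc x y z = begin
    (x *ₚ y) *ₚ z                 ≡⟨ *-[]ˡ (toℕ x * toℕ y) z ⟩
    [ toℕ x * toℕ y * toℕ z ]     ≡⟨ cong [_] (ℕ.*-assoc (toℕ x) (toℕ y) (toℕ z)) ⟩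
    [ toℕ x * (toℕ y * toℕ z) ]   ≡⟨ cong [_] (ℕ.*-comm (toℕ x) (toℕ y * toℕ z)) ⟩
    [ toℕ y * toℕ z * toℕ x ]     ≡⟨ *-[]ˡ (toℕ y * toℕ z) x ⟨
    (y *ₚ z) *ₚ x                 ≡⟨ *ₚ-comm (y *ₚ z) x ⟩
    x *ₚ (y *ₚ z)                 ∎
    where open ≡-Reasoning

  +ₚ-identityˡ : ∀ x → 0# +ₚ x ≡ x
  +ₚ-identityˡ x = trans (+-[]ˡ 0 x) ([]-toℕ x)

  *ₚ-identityˡ : ∀ x → 1# *ₚ x ≡ x
  *ₚ-identityˡ x = trans (*-[]ˡ 1 x) (trans (cong [_] (ℕ.*-identityˡ (toℕ x))) ([]-toℕ x))

  *ₚ-zeroˡ : ∀ x → 0# *ₚ x ≡ 0#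
  *ₚ-zeroˡ = *-[]ˡ 0

  *ₚ-distribʳ-+ₚ : ∀ x y z → (y +ₚ z) *ₚ x ≡ y *ₚ x +ₚ z *ₚ x
  *ₚ-distribʳ-+ₚ x y z = begin
    (y +ₚ z) *ₚ x                         ≡⟨ *-[]ˡ (toℕ y + toℕ z) x ⟩
    [ (toℕ y + toℕ z) * toℕ x ]           ≡⟨ cong [_] (ℕ.*-distribʳ-+ (toℕ x) (toℕ y) (toℕ z)) ⟩
    [ toℕ y * toℕ x + toℕ z * toℕ x ]     ≡⟨ []-+ (toℕ y * toℕ x) (toℕ z * toℕ x) ⟩
    y *ₚ x +ₚ z *ₚ x                      ∎
    where open ≡-Reasoning

  -ₚ-inverse : ∀ x → -ₚ x +ₚ x ≡ 0#
  -ₚ-inverse x = begin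
    -ₚ x +ₚ x               ≡⟨ +-[]ˡ (p ∸ toℕ x) x ⟩
    [ p ∸ toℕ x + toℕ x ]   ≡⟨ cong [_] (ℕ.m∸n+n≡m (ℕ.<⇒≤ (toℕ<n x))) ⟩
    [ p ]                   ≡⟨ p∣⇒[]≡0 ∣-refl ⟩
    0#                      ∎
    where open ≡-Reasoning

  isCommutativeMonoid : ∀ (_∙_ : Fin p → Fin p → Fin p) ε →
    (∀ x y z → (x ∙ y) ∙ z ≡ x ∙ (y ∙ z)) → (∀ x y → x ∙ y ≡ y ∙ x) →
    (∀ x → ε ∙ x ≡ x) → IsCommutativeMonoid _≡_ _∙_ ε
  isCommutativeMonoid _ _ assoc comm idˡ = record
    { isMonoid = record
      { isSemigroup = record
        { isMagma = record { isEquivalence = isEquivalence ; ∙-cong = cong₂ _ }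
        ; assoc   = assoc
        }
      ; identity = idˡ , λ x → trans (comm x _) (idˡ x)
      }
    ; comm = comm
    }

  -- A semiring is enough for the solver with natural coefficients; negatives enter its equations as
  -- variables, and `-ₚ-inverse` is applied separately.
  commutativeSemiring : CommutativeSemiring 0ℓ 0ℓ
  commutativeSemiring = record
    { isCommutativeSemiring = isCommutativeSemiringˡ record
      { +-isCommutativeMonoid = isCommutativeMonoid _+ₚ_ 0# +ₚ-assoc +ₚ-comm +ₚ-identityˡ
      ; *-isCommutativeMonoid = isCommutativeMonoid _*ₚ_ 1# *ₚ-assoc *ₚ-comm *ₚ-identityˡ
      ; distribʳ              = *ₚ-distribʳ-+ₚ
      ; zeroˡ                 = *ₚ-zeroˡ
      }
    }

  open CommutativeSemiring commutativeSemiring public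
    using () renaming (+-identityʳ to +ₚ-identityʳ; *-identityʳ to *ₚ-identityʳ; zeroʳ to *ₚ-zeroʳ)

  open SemiringSolver commutativeSemiring public
    using (solve; _:=_; _:+_; _:*_; con)

-- Inverses, cancellation and squares modulo a prime

module PrimeField (p : ℕ) .{{_ : NonZero p}} (p-prime : Prime p) where

  open Residues p public

  2≤p : 2 ≤ p
  2≤p = ℕ.nonTrivial⇒n>1 p {{prime⇒nonTrivial p-prime}}

  []≢0 : ∀ n → .{{_ : NonZero n}} → n < p → [ n ] ≢ 0#
  []≢0 n n<p eq = ℕ.<⇒≱ n<p (∣⇒≤ ([]≡0⇒p∣ eq))

  1≢0 : 1# ≢ 0#
  1≢0 = []≢0 1 2≤p

  -- Bézout for the coprime numbers p and x: depending on the sign in the identity, the coefficient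
  -- of x or its negative is the inverse.
  inverse : ∀ x → x ≢ 0# → ∃[ y ] y *ₚ x ≡ 1#
  inverse x x≢0 = bézout⇒inverse (coprime-Bézout (prime⇒coprime p-prime {{ℕ.≢-nonZero toℕx≢0}} (toℕ<n x)))
    where
    open ≡-Reasoning

    toℕx≢0 : toℕ x ≢ 0
    toℕx≢0 eq = x≢0 (trans (sym ([]-toℕ x)) (cong [_] eq))

    [p*] : ∀ k → [ k * p ] ≡ 0#
    [p*] k = p∣⇒[]≡0 (n∣m*n k)

    bézout⇒inverse : Bézout.Identity 1 p (toℕ x) → ∃[ y ] y *ₚ x ≡ 1#
    bézout⇒inverse (Bézout.-+ k l eq) = [ l ] , (begin
      [ l ] *ₚ x         ≡⟨ *-[]ˡ l x ⟩
      [ l * toℕ x ]      ≡⟨ cong [_] eq ⟨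
      [ 1 + k * p ]      ≡⟨ []-+ 1 (k * p) ⟩
      1# +ₚ [ k * p ]    ≡⟨ cong (1# +ₚ_) ([p*] k) ⟩
      1# +ₚ 0#           ≡⟨ +ₚ-identityʳ 1# ⟩
      1#                 ∎)
    bézout⇒inverse (Bézout.+- k l eq) = -ₚ [ l ] , (begin
      -ₚ [ l ] *ₚ x                                ≡⟨ +ₚ-identityʳ _ ⟨
      -ₚ [ l ] *ₚ x +ₚ 0#                          ≡⟨ cong (-ₚ [ l ] *ₚ x +ₚ_) 1+lx≡0 ⟨
      -ₚ [ l ] *ₚ x +ₚ (1# +ₚ [ l ] *ₚ x)          ≡⟨ solve 3 (λ n m z → n :* z :+ (con 1 :+ m :* z) := (n :+ m) :* z :+ con 1) refl (-ₚ [ l ]) [ l ] x ⟩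
      (-ₚ [ l ] +ₚ [ l ]) *ₚ x +ₚ 1#               ≡⟨ cong (λ t → t *ₚ x +ₚ 1#) (-ₚ-inverse [ l ]) ⟩
      0# *ₚ x +ₚ 1#                                ≡⟨ cong (_+ₚ 1#) (*ₚ-zeroˡ x) ⟩
      0# +ₚ 1#                                     ≡⟨ +ₚ-identityˡ 1# ⟩
      1#                                           ∎)
      where
      1+lx≡0 : 1# +ₚ [ l ] *ₚ x ≡ 0#
      1+lx≡0 = begin
        1# +ₚ [ l ] *ₚ x     ≡⟨ cong (1# +ₚ_) (*-[]ˡ l x) ⟩
        1# +ₚ [ l * toℕ x ]  ≡⟨ []-+ 1 (l * toℕ x) ⟨
        [ 1 + l * toℕ x ]    ≡⟨ cong [_] eq ⟩
        [ k * p ]            ≡⟨ [p*] k ⟩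
        0#                   ∎

  +ₚ-cancelˡ : ∀ x {y z} → x +ₚ y ≡ x +ₚ z → y ≡ z
  +ₚ-cancelˡ x {y} {z} eq = begin
    y                   ≡⟨ cancel y ⟨
    -ₚ x +ₚ (x +ₚ y)    ≡⟨ cong (-ₚ x +ₚ_) eq ⟩
    -ₚ x +ₚ (x +ₚ z)    ≡⟨ cancel z ⟩
    z                   ∎
    where
    open ≡-Reasoning
    cancel : ∀ t → -ₚ x +ₚ (x +ₚ t) ≡ t
    cancel t = trans (sym (+ₚ-assoc (-ₚ x) x t))
      (trans (cong (_+ₚ t) (-ₚ-inverse x)) (+ₚ-identityˡ t))

  -- Giving y - x through the equation x + d = y allows y to be replaced by x + d, which leaves
  -- subtraction-free identities for the solver.
  difference : ∀ x y → ∃[ d ] x +ₚ d ≡ y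
  difference x y = -ₚ x +ₚ y , trans (sym (+ₚ-assoc x (-ₚ x) y))
    (trans (cong (_+ₚ y) (trans (+ₚ-comm x (-ₚ x)) (-ₚ-inverse x))) (+ₚ-identityˡ y))

  ≢⇒difference≢0 : ∀ {x y d} → x +ₚ d ≡ y → y ≢ x → d ≢ 0#
  ≢⇒difference≢0 {x} eq y≢x refl = y≢x (trans (sym eq) (+ₚ-identityʳ x))

  +ₚ≡0⇒≡-ₚ : ∀ {x y} → x +ₚ y ≡ 0# → x ≡ -ₚ y
  +ₚ≡0⇒≡-ₚ {x} {y} eq = +ₚ-cancelˡ y (trans (+ₚ-comm y x)
    (trans eq (sym (trans (+ₚ-comm y (-ₚ y)) (-ₚ-inverse y)))))

  -ₚ-≢0 : ∀ {x} → x ≢ 0# → -ₚ x ≢ 0#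
  -ₚ-≢0 {x} x≢0 eq = x≢0 (trans (sym (+ₚ-identityˡ x)) (trans (cong (_+ₚ x) (sym eq)) (-ₚ-inverse x)))

  quotient : ∀ x y → x ≢ 0# → ∃[ q ] q *ₚ x ≡ y
  quotient x y x≢0 with x⁻¹ , eq ← inverse x x≢0 =
    y *ₚ x⁻¹ , trans (*ₚ-assoc y x⁻¹ x) (trans (cong (y *ₚ_) eq) (*ₚ-identityʳ y))

  x*y≡0⇒y≡0 : ∀ x y → x ≢ 0# → x *ₚ y ≡ 0# → y ≡ 0#
  x*y≡0⇒y≡0 x y x≢0 xy≡0 with x⁻¹ , eq ← inverse x x≢0 = begin
    y                 ≡⟨ *ₚ-identityˡ y ⟨
    1# *ₚ y           ≡⟨ cong (_*ₚ y) eq ⟨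
    x⁻¹ *ₚ x *ₚ y     ≡⟨ *ₚ-assoc x⁻¹ x y ⟩
    x⁻¹ *ₚ (x *ₚ y)   ≡⟨ cong (x⁻¹ *ₚ_) xy≡0 ⟩
    x⁻¹ *ₚ 0#         ≡⟨ *ₚ-zeroʳ x⁻¹ ⟩
    0#                ∎
    where open ≡-Reasoning

  *ₚ-≢0 : ∀ {x y} → x ≢ 0# → y ≢ 0# → x *ₚ y ≢ 0#
  *ₚ-≢0 {x} {y} x≢0 y≢0 xy≡0 = y≢0 (x*y≡0⇒y≡0 x y x≢0 xy≡0)

  *ₚ-cancelʳ : ∀ z {x y} → z ≢ 0# → x *ₚ z ≡ y *ₚ z → x ≡ y
  *ₚ-cancelʳ z {x} {y} z≢0 eq with d , x+d≡y ← difference x y =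
    trans (sym (+ₚ-identityʳ x)) (trans (cong (x +ₚ_) (sym d≡0)) x+d≡y)
    where
    open ≡-Reasoning
    d≡0 : d ≡ 0#
    d≡0 = x*y≡0⇒y≡0 z d z≢0 (+ₚ-cancelˡ (x *ₚ z) (begin
      x *ₚ z +ₚ z *ₚ d    ≡⟨ solve 3 (λ x z d → x :* z :+ z :* d := (x :+ d) :* z) refl x z d ⟩
      (x +ₚ d) *ₚ z       ≡⟨ cong (_*ₚ z) x+d≡y ⟩
      y *ₚ z              ≡⟨ eq ⟨
      x *ₚ z              ≡⟨ +ₚ-identityʳ _ ⟨
      x *ₚ z +ₚ 0#        ∎))

  ≢0⇒U : ∀ {x} → x ≢ 0# → U p x
  ≢0⇒U {x} x≢0 with x⁻¹ , eq ← inverse x x≢0 = x⁻¹ , eq , trans (*ₚ-comm x x⁻¹) eq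

  U⇒≢0 : ∀ {x} → U p x → x ≢ 0#
  U⇒≢0 {x} (x⁻¹ , eq , _) refl = 1≢0 (trans (sym eq) (*ₚ-zeroʳ x⁻¹))

  U? : ∀ x → Dec (U p x)
  U? x = any? λ y → (y *ₚ x ≟ 1#) ×-dec (x *ₚ y ≟ 1#)

  Q? : ∀ y → Dec (Q p y)
  Q? y = any? λ x → U? x ×-dec (y ≟ x *ₚ x)

  Q-square : ∀ {x} → x ≢ 0# → Q p (x *ₚ x)
  Q-square {x} x≢0 = x , ≢0⇒U x≢0 , refl

  Q⇒≢0 : ∀ {x} → Q p x → x ≢ 0#
  Q⇒≢0 (_ , u , refl) = *ₚ-≢0 (U⇒≢0 u) (U⇒≢0 u)

  Q-1 : Q p 1#
  Q-1 = subst (Q p) (*ₚ-identityˡ 1#) (Q-square 1≢0)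

  Q-* : ∀ {x y} → Q p x → Q p y → Q p (x *ₚ y)
  Q-* (a , ua , refl) (b , ub , refl) = subst (Q p)
    (solve 2 (λ a b → (a :* b) :* (a :* b) := (a :* a) :* (b :* b)) refl a b)
    (Q-square (*ₚ-≢0 (U⇒≢0 ua) (U⇒≢0 ub)))

  -- If x = a² and y = b², then the quotient is the square of b/a.
  Q-quotient : ∀ {x y} → Q p x → Q p y → ∃[ q ] Q p q × q *ₚ x ≡ y
  Q-quotient (a , ua , refl) (b , ub , refl) with q , refl ← quotient a b (U⇒≢0 ua) =
    q *ₚ q , Q-square {q} (λ { refl → U⇒≢0 ub (*ₚ-zeroˡ a) }) ,
    solve 2 (λ q a → (q :* q) :* (a :* a) := (q :* a) :* (q :* a)) refl q a

-- Classes modulo squares and the existence of a nonresidue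

module OddPrimeField (p : ℕ) .{{_ : NonZero p}} (p-prime : Prime p) (p-odd : 2 ∤ p) where

  open PrimeField p p-prime public

  half : ∃[ h ] p ≡ 1 + (h + h)
  half with p % 2 in p%2≡r | m%n<n p 2 | m≡m%n+[m/n]*n p 2
  ... | 0 | _ | _      = contradiction (m%n≡0⇒n∣m p 2 p%2≡r) p-odd
  ... | 1 | _ | p≡1+2h = p / 2 , trans p≡1+2h (cong suc (trans (ℕ.*-comm (p / 2) 2) (cong (p / 2 +_) (ℕ.+-identityʳ (p / 2)))))
  ... | suc (suc _) | s≤s (s≤s ()) | _

  2<p : 2 < p
  2<p = ℕ.≤∧≢⇒< 2≤p (λ { refl → p-odd ∣-refl })

  -- From y² - x² = (x + y)(y - x), where the first factor is nonzero.
  square-injective : ∀ x y → x +ₚ y ≢ 0# → x *ₚ x ≡ y *ₚ y → x ≡ y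
  square-injective x y x+y≢0 eq with d , refl ← difference x y =
    trans (sym (+ₚ-identityʳ x)) (cong (x +ₚ_) (sym d≡0))
    where
    open ≡-Reasoning
    d≡0 : d ≡ 0#
    d≡0 = x*y≡0⇒y≡0 _ d x+y≢0 (+ₚ-cancelˡ (x *ₚ x) (begin
      x *ₚ x +ₚ (x +ₚ (x +ₚ d)) *ₚ d    ≡⟨ solve 2 (λ x d → x :* x :+ (x :+ (x :+ d)) :* d := (x :+ d) :* (x :+ d)) refl x d ⟩
      (x +ₚ d) *ₚ (x +ₚ d)              ≡⟨ eq ⟨
      x *ₚ x                            ≡⟨ +ₚ-identityʳ _ ⟨
      x *ₚ x +ₚ 0#                      ∎))

  -- For nonzero x and y: equality of their cosets modulo the subgroup `Q` of the units.
  SameClass : Fin p → Fin p → Set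
  SameClass x y = ∃[ q ] Q p q × q *ₚ x ≡ y

  SameClass-cancel : ∀ {x y s t} → Q p s → Q p t → x *ₚ s ≡ y *ₚ t → SameClass x y
  SameClass-cancel {x} {y} {s} {t} Qs Qt eq with q , Qq , qt≡s ← Q-quotient Qt Qs =
    q , Qq , *ₚ-cancelʳ t (Q⇒≢0 Qt) (begin
      q *ₚ x *ₚ t     ≡⟨ solve 3 (λ q x t → q :* x :* t := x :* (q :* t)) refl q x t ⟩
      x *ₚ (q *ₚ t)   ≡⟨ cong (x *ₚ_) qt≡s ⟩
      x *ₚ s          ≡⟨ eq ⟩
      y *ₚ t          ∎)
    where open ≡-Reasoning

  -- Writing p = 1 + 2h, the squares of 1, …, h are distinct and nonzero, so x, y
  -- and z times them give 3h > p - 1 nonzero values, and some two of them agree.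
  two-in-same-class : ∀ {x y z} → x ≢ 0# → y ≢ 0# → z ≢ 0# →
    SameClass x y ⊎ SameClass x z ⊎ SameClass y z
  two-in-same-class {x} {y} {z} x≢0 y≢0 z≢0 with h , p≡1+2h ← half =
    collision (pigeonhole p<1+3h value)
    where
    open ≡-Reasoning

    element : Fin 3 → Fin p
    element zero             = x
    element (suc zero)       = y
    element (suc (suc zero)) = z

    element≢0 : ∀ c → element c ≢ 0#
    element≢0 zero             = x≢0
    element≢0 (suc zero)       = y≢0
    element≢0 (suc (suc zero)) = z≢0

    root : Fin h → Fin p
    root i = [ suc (toℕ i) ]

    multiple : Fin 3 × Fin h → Fin p
    multiple (c , i) = element c *ₚ (root i *ₚ root i)

    value : Fin (1 + 3 * h) → Fin p
    -- The value 0 is one more pigeon, distinct from all multiples; it makes the count exceed p also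
    -- for h = 1.
    value zero    = 0#
    value (suc k) = multiple (remQuot h k)

    ≤2h⇒<p : ∀ m → m ≤ h + h → m < p
    ≤2h⇒<p m m≤2h = subst (m <_) (sym p≡1+2h) (s≤s m≤2h)

    root≢0 : ∀ i → root i ≢ 0#
    root≢0 i = []≢0 _ (≤2h⇒<p _ (ℕ.≤-trans (toℕ<n i) (ℕ.m≤m+n h h)))

    root+root≢0 : ∀ i j → root i +ₚ root j ≢ 0#
    -- The sum of two numbers from 1, ..., h lies between 2 and 2h = p - 1.
    root+root≢0 i j eq = []≢0 (suc (toℕ i) + suc (toℕ j))
      (≤2h⇒<p _ (ℕ.+-mono-≤ (toℕ<n i) (toℕ<n j))) (trans ([]-+ (suc (toℕ i)) (suc (toℕ j))) eq)

    root-injective : ∀ i j → root i ≡ root j → i ≡ j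
    root-injective i j eq = toℕ-injective (ℕ.suc-injective (begin
      suc (toℕ i)       ≡⟨ toℕ-root i ⟨
      toℕ (root i)      ≡⟨ cong toℕ eq ⟩
      toℕ (root j)      ≡⟨ toℕ-root j ⟩
      suc (toℕ j)       ∎))
      where
      toℕ-root : ∀ i → toℕ (root i) ≡ suc (toℕ i)
      toℕ-root i = trans (toℕ-[] _) (m<n⇒m%n≡m (≤2h⇒<p _ (ℕ.≤-trans (toℕ<n i) (ℕ.m≤m+n h h))))

    1≤h : ∀ h → p ≡ 1 + (h + h) → 1 ≤ h
    1≤h zero    p≡1 = contradiction (subst (2 ≤_) p≡1 2≤p) λ { (s≤s ()) }
    1≤h (suc _) _   = s≤s z≤n

    p<1+3h : p < 1 + 3 * h
    p<1+3h = s≤s (subst (_≤ 3 * h) (sym p≡1+2h) (ℕ.≤-trans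
      (ℕ.+-monoˡ-≤ (h + h) (1≤h h p≡1+2h))
      (ℕ.≤-reflexive (cong (λ k → h + (h + k)) (sym (ℕ.+-identityʳ h))))))

    multiple≢0 : ∀ k → multiple k ≢ 0#
    multiple≢0 (c , i) = *ₚ-≢0 (element≢0 c) (*ₚ-≢0 (root≢0 i) (root≢0 i))

    Q-root² : ∀ i → Q p (root i *ₚ root i)
    Q-root² i = Q-square (root≢0 i)

    multiple-injectiveʳ : ∀ c {i i′} → multiple (c , i) ≡ multiple (c , i′) → i ≡ i′
    multiple-injectiveʳ c {i} {i′} eq = root-injective i i′ (square-injective _ _ (root+root≢0 i i′)
      (*ₚ-cancelʳ (element c) (element≢0 c) (trans (*ₚ-comm _ (element c)) (trans eq (*ₚ-comm (element c) _)))))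

    equal-multiples : ∀ u v → multiple u ≡ multiple v → u ≢ v →
      SameClass x y ⊎ SameClass x z ⊎ SameClass y z
    equal-multiples (zero , i) (suc zero , j) eq _ = inj₁ (SameClass-cancel (Q-root² i) (Q-root² j) eq)
    equal-multiples (zero , i) (suc (suc zero) , j) eq _ = inj₂ (inj₁ (SameClass-cancel (Q-root² i) (Q-root² j) eq))
    equal-multiples (suc zero , i) (suc (suc zero) , j) eq _ = inj₂ (inj₂ (SameClass-cancel (Q-root² i) (Q-root² j) eq))
    equal-multiples (suc zero , i) (zero , j) eq _ =
      equal-multiples (zero , j) (suc zero , i) (sym eq) (λ ())
    equal-multiples (suc (suc zero) , i) (zero , j) eq _ =
      equal-multiples (zero , j) (suc (suc zero) , i) (sym eq) (λ ())
    equal-multiples (suc (suc zero) , i) (suc zero , j) eq _ =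
      equal-multiples (suc zero , j) (suc (suc zero) , i) (sym eq) (λ ())
    equal-multiples (zero , _) (zero , _) eq u≢v =
      contradiction (cong (_ ,_) (multiple-injectiveʳ zero eq)) u≢v
    equal-multiples (suc zero , _) (suc zero , _) eq u≢v =
      contradiction (cong (_ ,_) (multiple-injectiveʳ (suc zero) eq)) u≢v
    equal-multiples (suc (suc zero) , _) (suc (suc zero) , _) eq u≢v =
      contradiction (cong (_ ,_) (multiple-injectiveʳ (suc (suc zero)) eq)) u≢v

    remQuot-injective : ∀ k l → remQuot {3} h k ≡ remQuot {3} h l → k ≡ l
    remQuot-injective k l eq = trans (sym (combine-remQuot {3} h k))
      (trans (cong (uncurry combine) eq) (combine-remQuot {3} h l))

    collision : ∃₂ (λ k l → toℕ k < toℕ l × value k ≡ value l) →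
      SameClass x y ⊎ SameClass x z ⊎ SameClass y z
    collision (zero  , suc l , _       , eq) = contradiction (sym eq) (multiple≢0 (remQuot h l))
    collision (suc k , suc l , s≤s k<l , eq) = equal-multiples _ _ eq
      (λ eq′ → ℕ.<⇒≢ k<l (cong toℕ (remQuot-injective k l eq′)))

  2≢0 : [ 2 ] ≢ 0#
  2≢0 = []≢0 2 2<p

  -- If every element had a square root, so would the negative of the root of 1
  -- be an additional preimage of 1, making p + 1 distinct elements.
  not-all-squares : ¬ (∀ y → Q p y ⊎ y ≡ 0#)
  not-all-squares all = collision (pigeonhole ℕ.≤-refl roots)
    where
    open ≡-Reasoning

    sqrt : ∀ y → ∃[ x ] y ≡ x *ₚ x
    sqrt y with all y
    ... | inj₁ (x , _ , eq) = x , eq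
    ... | inj₂ refl         = 0# , sym (*ₚ-zeroˡ 0#)

    ρ : Fin p → Fin p
    ρ y = proj₁ (sqrt y)

    ρ² : ∀ y → y ≡ ρ y *ₚ ρ y
    ρ² y = proj₂ (sqrt y)

    n : Fin p
    n = -ₚ ρ 1#

    n²≡1 : n *ₚ n ≡ 1#
    n²≡1 = trans (+ₚ-cancelˡ (n *ₚ ρ 1#) (begin
      n *ₚ ρ 1# +ₚ n *ₚ n          ≡⟨ solve 2 (λ n r → n :* r :+ n :* n := (n :+ r) :* n) refl n (ρ 1#) ⟩
      (n +ₚ ρ 1#) *ₚ n             ≡⟨ cong (_*ₚ n) (-ₚ-inverse (ρ 1#)) ⟩
      0# *ₚ n                      ≡⟨ trans (*ₚ-zeroˡ n) (sym (*ₚ-zeroˡ (ρ 1#))) ⟩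
      0# *ₚ ρ 1#                   ≡⟨ cong (_*ₚ ρ 1#) (-ₚ-inverse (ρ 1#)) ⟨
      (n +ₚ ρ 1#) *ₚ ρ 1#          ≡⟨ solve 2 (λ n r → (n :+ r) :* r := n :* r :+ r :* r) refl n (ρ 1#) ⟩
      n *ₚ ρ 1# +ₚ ρ 1# *ₚ ρ 1#    ∎)) (sym (ρ² 1#))

    ρ1≢0 : ρ 1# ≢ 0#
    ρ1≢0 eq = 1≢0 (trans (ρ² 1#) (trans (cong (_*ₚ ρ 1#) eq) (*ₚ-zeroˡ _)))

    n≢ρ : ∀ y → n ≢ ρ y
    n≢ρ y n≡ρy = *ₚ-≢0 2≢0 ρ1≢0 (begin
      [ 2 ] *ₚ ρ 1#       ≡⟨ cong (_*ₚ ρ 1#) ([]-+ 1 1) ⟩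
      (1# +ₚ 1#) *ₚ ρ 1#  ≡⟨ solve 1 (λ r → (con 1 :+ con 1) :* r := r :+ r) refl (ρ 1#) ⟩
      ρ 1# +ₚ ρ 1#        ≡⟨ cong (_+ₚ ρ 1#) n≡ρ1 ⟨
      n +ₚ ρ 1#           ≡⟨ -ₚ-inverse (ρ 1#) ⟩
      0#                  ∎)
      where
      -- Squaring n = ρ y gives y = n² = 1.
      n≡ρ1 : n ≡ ρ 1#
      n≡ρ1 = trans n≡ρy (cong ρ (trans (ρ² y) (trans (cong₂ _*ₚ_ (sym n≡ρy) (sym n≡ρy)) n²≡1)))

    roots : Fin (suc p) → Fin p
    roots zero    = n
    roots (suc y) = ρ y

    collision : ¬ ∃₂ (λ i j → toℕ i < toℕ j × roots i ≡ roots j)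
    collision (zero  , suc y  , _       , eq) = n≢ρ y eq
    collision (suc y , suc y′ , s≤s y<y′ , eq) = ℕ.<⇒≢ y<y′
      (cong toℕ (trans (ρ² y) (trans (cong₂ _*ₚ_ eq eq) (sym (ρ² y′)))))

  nonresidue : ∃[ r ] r ≢ 0# × ¬ Q p r
  nonresidue with r , ¬P ← ¬∀⟶∃¬ p (λ y → Q p y ⊎ y ≡ 0#) (λ y → Q? y ⊎-dec (y ≟ 0#)) not-all-squares =
    r , ¬P ∘ inj₂ , ¬P ∘ inj₁

-- Sums of residues for p ≥ 7

module LargePrimeField (p : ℕ) .{{_ : NonZero p}} (p-prime : Prime p) (p-odd : 2 ∤ p) (7≤p : 7 ≤ p) where

  open OddPrimeField p p-prime p-odd public

  digit≢0 : ∀ n → .{{_ : NonZero n}} → n < 7 → [ n ] ≢ 0#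
  digit≢0 n n<7 = []≢0 n (ℕ.<-≤-trans n<7 7≤p)

  Q-digit² : ∀ n → .{{_ : NonZero n}} → n < 7 → Q p [ n * n ]
  Q-digit² n n<7 = subst (Q p) (sym ([]-* n n)) (Q-square (digit≢0 n n<7))

  -- Descent from a nonresidue to the first number whose predecessor is a residue; it stops because
  -- 1 is a residue.
  residue-step : ∀ n → suc n < p → ¬ Q p [ suc n ] →
    ∃[ m ] suc (suc m) < p × Q p [ suc m ] × ¬ Q p [ suc (suc m) ]
  residue-step zero    _     ¬Q1 = contradiction Q-1 ¬Q1
  residue-step (suc n) n+2<p ¬Q with Q? [ suc n ]
  ... | yes Q[1+n] = n , n+2<p , Q[1+n] , ¬Q
  ... | no ¬Q[1+n] = residue-step n (ℕ.<-trans (ℕ.n<1+n (suc n)) n+2<p) ¬Q[1+n]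

  SumOfTwo : Fin p → Set
  SumOfTwo c = ∃₂ λ a b → Q p a × Q p b × a +ₚ b ≡ c

  -- A residue is a multiple of 5² = 3² + 4².  Some nonresidue r is the sum of
  -- 1 and the residue r - 1, and the other nonresidues are in the class of r.
  ≢0⇒sum-of-two : ∀ {c} → c ≢ 0# → SumOfTwo c
  ≢0⇒sum-of-two {c} c≢0 with Q? c
  ... | yes Qc with q , Qq , refl ← Q-quotient (Q-digit² 5 (ℕ.m≤m+n 6 1)) Qc =
    q *ₚ [ 9 ] , q *ₚ [ 16 ] , Q-* Qq (Q-digit² 3 (ℕ.m≤m+n 4 3)) , Q-* Qq (Q-digit² 4 (ℕ.m≤m+n 5 2)) , (begin
      q *ₚ [ 9 ] +ₚ q *ₚ [ 16 ]    ≡⟨ solve 3 (λ q x y → q :* x :+ q :* y := q :* (x :+ y)) refl q [ 9 ] [ 16 ] ⟩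
      q *ₚ ([ 9 ] +ₚ [ 16 ])       ≡⟨ cong (q *ₚ_) ([]-+ 9 16) ⟨
      q *ₚ [ 25 ]                  ∎)
    where open ≡-Reasoning
  ... | no ¬Qc = nonresidue-case (toℕ c) (toℕ<n c) ([]-toℕ c)
    where
    open ≡-Reasoning

    in-class : ∀ m → suc (suc m) < p → Q p [ suc m ] → ¬ Q p [ suc (suc m) ] → SumOfTwo c
    in-class m r<p Qm ¬Qr with two-in-same-class 1≢0 ([]≢0 (suc (suc m)) r<p) c≢0
    ... | inj₁ (q , Qq , eq)        = contradiction (subst (Q p) (trans (sym (*ₚ-identityʳ q)) eq) Qq) ¬Qr
    ... | inj₂ (inj₁ (q , Qq , eq)) = contradiction (subst (Q p) (trans (sym (*ₚ-identityʳ q)) eq) Qq) ¬Qc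
    ... | inj₂ (inj₂ (q , Qq , eq)) = q *ₚ 1# , q *ₚ [ suc m ] , Q-* Qq Q-1 , Q-* Qq Qm , (begin
      q *ₚ 1# +ₚ q *ₚ [ suc m ]    ≡⟨ solve 3 (λ q x y → q :* x :+ q :* y := q :* (x :+ y)) refl q 1# [ suc m ] ⟩
      q *ₚ (1# +ₚ [ suc m ])       ≡⟨ cong (q *ₚ_) ([]-+ 1 (suc m)) ⟨
      q *ₚ [ suc (suc m) ]         ≡⟨ eq ⟩
      c                            ∎)

    nonresidue-case : ∀ n → n < p → [ n ] ≡ c → SumOfTwo c
    nonresidue-case zero    _   eq = contradiction (sym eq) c≢0
    nonresidue-case (suc n) n<p eq
      with m , r<p , Qm , ¬Qr ← residue-step n n<p (¬Qc ∘ subst (Q p) eq) = in-class m r<p Qm ¬Qr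

  []-≢-+ : ∀ m {d} → [ d ] ≢ 0# → [ m ] ≢ [ m + d ]
  []-≢-+ m {d} d≢0 eq = d≢0 (sym (+ₚ-cancelˡ [ m ] (trans (+ₚ-identityʳ [ m ]) (trans eq ([]-+ m d)))))

  -- For p = 7 the number 8 is not below p, so it is factored as 2 · 4.
  8≢0 : [ 8 ] ≢ 0#
  8≢0 eq = *ₚ-≢0 2≢0 (digit≢0 4 (ℕ.m≤m+n 5 2)) (trans (sym ([]-* 2 4)) eq)

  1≢4 : [ 1 ] ≢ [ 4 ]
  1≢4 = []-≢-+ 1 (digit≢0 3 (ℕ.m≤m+n 4 3))

  1≢9 : [ 1 ] ≢ [ 9 ]
  1≢9 = []-≢-+ 1 8≢0

  4≢9 : [ 4 ] ≢ [ 9 ]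
  4≢9 = []-≢-+ 4 (digit≢0 5 (ℕ.m≤m+n 6 1))

  -- Of the weights 1, 4 and 9, each condition excludes at most one.
  avoiding : ∀ {x y} → x ≢ 0# → y ≢ 0# → ∀ s t → ∃[ a ] Q p a × a *ₚ x ≢ s × a *ₚ y ≢ t
  avoiding {x} {y} x≢0 y≢0 s t with avoids? [ 1 ] | avoids? [ 4 ] | avoids? [ 9 ]
    where
    avoids? : ∀ a → (a *ₚ x ≢ s × a *ₚ y ≢ t) ⊎ a *ₚ x ≡ s ⊎ a *ₚ y ≡ t
    avoids? a with a *ₚ x ≟ s | a *ₚ y ≟ t
    ... | yes eq | _      = inj₂ (inj₁ eq)
    ... | _      | yes eq = inj₂ (inj₂ eq)
    ... | no ≢s  | no ≢t  = inj₁ (≢s , ≢t)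
  ... | inj₁ ok | _       | _       = [ 1 ] , Q-1 , ok
  ... | _       | inj₁ ok | _       = [ 4 ] , Q-digit² 2 (ℕ.m≤m+n 3 4) , ok
  ... | _       | _       | inj₁ ok = [ 9 ] , Q-digit² 3 (ℕ.m≤m+n 4 3) , ok
  ... | inj₂ (inj₁ u) | inj₂ (inj₁ v) | _             = contradiction (*ₚ-cancelʳ x x≢0 (trans u (sym v))) 1≢4
  ... | inj₂ (inj₂ u) | inj₂ (inj₂ v) | _             = contradiction (*ₚ-cancelʳ y y≢0 (trans u (sym v))) 1≢4
  ... | inj₂ (inj₁ u) | _             | inj₂ (inj₁ w) = contradiction (*ₚ-cancelʳ x x≢0 (trans u (sym w))) 1≢9
  ... | inj₂ (inj₂ u) | _             | inj₂ (inj₂ w) = contradiction (*ₚ-cancelʳ y y≢0 (trans u (sym w))) 1≢9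
  ... | _             | inj₂ (inj₁ v) | inj₂ (inj₁ w) = contradiction (*ₚ-cancelʳ x x≢0 (trans v (sym w))) 4≢9
  ... | _             | inj₂ (inj₂ v) | inj₂ (inj₂ w) = contradiction (*ₚ-cancelʳ y y≢0 (trans v (sym w))) 4≢9

  -- A weight c with c z ≠ t makes k = (t - c z)/x nonzero, hence a sum a + b of two residues. Since
  -- y = q x, the weight b/q on y contributes b x.
  ternary-form : ∀ {x y z} → SameClass x y → x ≢ 0# → z ≢ 0# → ∀ t →
    ∃[ a ] ∃[ b ] ∃[ c ] Q p a × Q p b × Q p c × a *ₚ x +ₚ b *ₚ y +ₚ c *ₚ z ≡ t
  ternary-form {x} {y} {z} (q , Qq , refl) x≢0 z≢0 t
    with c , Qc , cz≢t , _ ← avoiding z≢0 z≢0 t t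
    with e , cz+e≡t ← difference (c *ₚ z) t
    with k , refl ← quotient x e x≢0
    with a , b , Qa , Qb , refl ← ≢0⇒sum-of-two {k} (λ { refl → cz≢t
      (trans (sym (+ₚ-identityʳ (c *ₚ z))) (trans (cong (c *ₚ z +ₚ_) (sym (*ₚ-zeroˡ x))) cz+e≡t)) })
    with b′ , Qb′ , b′q≡b ← Q-quotient Qq Qb =
    a , b′ , c , Qa , Qb′ , Qc , (begin
      a *ₚ x +ₚ b′ *ₚ (q *ₚ x) +ₚ c *ₚ z    ≡⟨ solve 5 (λ a b q x w → a :* x :+ b :* (q :* x) :+ w := w :+ (a :+ b :* q) :* x) refl a b′ q x (c *ₚ z) ⟩
      c *ₚ z +ₚ (a +ₚ b′ *ₚ q) *ₚ x         ≡⟨ cong (λ d → c *ₚ z +ₚ (a +ₚ d) *ₚ x) b′q≡b ⟩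
      c *ₚ z +ₚ (a +ₚ b) *ₚ x               ≡⟨ cz+e≡t ⟩
      t                                     ∎)
    where open ≡-Reasoning

  -- Two of the three coefficients share a class, and `ternary-form` applies after reordering.
  ternary-form-universal : ∀ {x y z} → x ≢ 0# → y ≢ 0# → z ≢ 0# → ∀ t →
    ∃[ a ] ∃[ b ] ∃[ c ] Q p a × Q p b × Q p c × a *ₚ x +ₚ b *ₚ y +ₚ c *ₚ z ≡ t
  ternary-form-universal {x} {y} {z} x≢0 y≢0 z≢0 t with two-in-same-class x≢0 y≢0 z≢0
  ... | inj₁ x~y = ternary-form x~y x≢0 z≢0 t
  ... | inj₂ (inj₁ x~z) with a , c , b , Qa , Qc , Qb , eq ← ternary-form x~z x≢0 y≢0 t =
    a , b , c , Qa , Qb , Qc ,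
    trans (solve 3 (λ u v w → u :+ v :+ w := u :+ w :+ v) refl (a *ₚ x) (b *ₚ y) (c *ₚ z)) eq
  ... | inj₂ (inj₂ y~z) with b , c , a , Qb , Qc , Qa , eq ← ternary-form y~z y≢0 x≢0 t =
    a , b , c , Qa , Qb , Qc ,
    trans (solve 3 (λ u v w → u :+ v :+ w := v :+ w :+ u) refl (a *ₚ x) (b *ₚ y) (c *ₚ z)) eq

-- Rearrangement and pigeonhole arguments for lists

module _ {A : Set} where

  member-to-front : ∀ {x : A} {xs} → x ∈ xs → ∃[ ys ] xs ↭ x ∷ ys
  member-to-front {x} x∈xs with ys , zs , refl ← ∈-∃++ x∈xs = ys ++ zs , shift x ys zs

  repeated-to-front : ∀ (xs : List A) i j → toℕ i < toℕ j → lookup xs i ≡ lookup xs j →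
    ∃₂ λ x ys → xs ↭ x ∷ x ∷ ys
  repeated-to-front (x ∷ xs) zero (suc j) _ eq
    with ys , xs↭ ← member-to-front (subst (_∈ xs) (sym eq) (∈-lookup j)) = x , ys , prep x xs↭
  repeated-to-front (x ∷ xs) (suc i) (suc j) (s≤s i<j) eq
    with y , ys , xs↭ ← repeated-to-front xs i j i<j eq =
    y , x ∷ ys , ↭-trans (prep x xs↭) (shifts (x ∷ []) (y ∷ y ∷ []))

  prefix : ∀ n (xs : List A) → n ≤ length xs → ∃[ ys ] toList {n = n} ys ⊆ xs
  prefix zero    xs       _           = [] , minimum xs
  prefix (suc n) (x ∷ xs) (s≤s n≤∣xs∣) with ys , ys⊆xs ← prefix n xs n≤∣xs∣ = x ∷ ys , refl ∷ ys⊆xs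

module _ {n : ℕ} where

  pigeonhole-list : ∀ (xs : List (Fin n)) → n < length xs → ∃₂ λ x ys → xs ↭ x ∷ x ∷ ys
  pigeonhole-list xs n<∣xs∣ with i , j , i<j , eq ← pigeonhole n<∣xs∣ (lookup xs) =
    repeated-to-front xs i j i<j eq

  gather : ∀ (u : Fin n) xs → ∃₂ λ m ys → xs ↭ replicate m u ++ ys × List.All (_≢ u) ys
  gather u []       = 0 , [] , refl , []
  gather u (x ∷ xs) with m , ys , xs↭ , ys≢u ← gather u xs | x ≟ u
  ... | yes refl = suc m , ys , prep u xs↭ , ys≢u
  ... | no x≢u   = m , x ∷ ys , ↭-trans (prep x xs↭) (shifts (x ∷ []) (replicate m u)) , x≢u ∷ ys≢u

  -- The pigeonhole principle gives a pair u, u, and again a pair v, v after one u is set aside. If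
  -- u = v, this is a triple. Otherwise the other u is still among the remaining terms, and a fifth
  -- term w either completes a triple or differs from both.
  triple-or-two-pairs : ∀ (xs : List (Fin n)) → 2 < n → length xs ≡ n + 2 →
    (∃₂ λ u zs → xs ↭ u ∷ u ∷ u ∷ zs) ⊎
    (∃[ u ] ∃[ v ] ∃[ w ] ∃[ zs ] xs ↭ u ∷ u ∷ v ∷ v ∷ w ∷ zs × u ≢ v × w ≢ u × w ≢ v)
  triple-or-two-pairs xs 2<n ∣xs∣
    with u , ys , xs↭uuys ← pigeonhole-list xs (subst (n <_) (sym ∣xs∣) (ℕ.m<m+n n z<s))
    with v , zs , uys↭vvzs ← pigeonhole-list (u ∷ ys) (ℕ.≤-reflexive (ℕ.suc-injective
           (trans (ℕ.+-comm 2 n) (trans (sym ∣xs∣) (↭-length xs↭uuys)))))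
    with xs↭uvvzs ← ↭-trans xs↭uuys (prep u uys↭vvzs) | u ≟ v
  ... | yes refl = inj₁ (u , zs , xs↭uvvzs)
  ... | no u≢v with ∈-resp-↭ uys↭vvzs (here refl)
  ...   | here u≡v                 = contradiction u≡v u≢v
  ...   | there (here u≡v)         = contradiction u≡v u≢v
  ...   | there (there u∈zs) with member-to-front u∈zs
  -- Without a fifth term, n + 2 = 4.
  ...     | [] , zs↭ = contradiction 2<n (ℕ.<-irrefl (ℕ.+-cancelʳ-≡ 2 2 n
      (trans (sym (↭-length (↭-trans xs↭uvvzs (prep u (prep v (prep v zs↭)))))) ∣xs∣)))
  ...     | w ∷ ws , zs↭ = fifth (↭-trans xs↭uvvzs (prep u (↭-trans (prep v (prep v zs↭)) (shifts (v ∷ v ∷ []) (u ∷ [])))))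
    where
    fifth : xs ↭ u ∷ u ∷ v ∷ v ∷ w ∷ ws → _
    fifth xs↭ with w ≟ u | w ≟ v
    ... | yes refl | _        = inj₁ (u , v ∷ v ∷ ws , ↭-trans xs↭ (prep u (prep u (shifts (v ∷ v ∷ []) (u ∷ [])))))
    ... | _        | yes refl = inj₁ (v , u ∷ u ∷ ws , ↭-trans xs↭ (shifts (u ∷ u ∷ []) (v ∷ v ∷ v ∷ [])))
    ... | no w≢u   | no w≢v   = inj₂ (u , v , w , ws , xs↭ , u≢v , w≢u , w≢v)

-- Weighted selections of terms

module Selections (p : ℕ) .{{_ : NonZero p}} (p-prime : Prime p) where

  open PrimeField p p-prime

  -- Selection xs n s t: some n terms of xs, weighted by elements of Q, have weights
  -- summing to s and weighted sum t.
  data Selection : List (Fin p) → ℕ → Fin p → Fin p → Set where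
    []   : Selection [] 0 0# 0#
    skip : ∀ {x xs n s t} → Selection xs n s t → Selection (x ∷ xs) n s t
    pick : ∀ {x xs n s t a} → Q p a → Selection xs n s t →
           Selection (x ∷ xs) (suc n) (a +ₚ s) (a *ₚ x +ₚ t)

  -- Both sums are symmetric in the terms, so the upper bound may bring any convenient terms to the
  -- front.
  Selection-resp-↭ : ∀ {xs ys n s t} → xs ↭ ys → Selection xs n s t → Selection ys n s t
  Selection-resp-↭ refl σ = σ
  Selection-resp-↭ (prep x π) (skip σ)    = skip (Selection-resp-↭ π σ)
  Selection-resp-↭ (prep x π) (pick Qa σ) = pick Qa (Selection-resp-↭ π σ)
  Selection-resp-↭ (swap x y π) (skip (skip σ))    = skip (skip (Selection-resp-↭ π σ))
  Selection-resp-↭ (swap x y π) (skip (pick Qb σ)) = pick Qb (skip (Selection-resp-↭ π σ))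
  Selection-resp-↭ (swap x y π) (pick Qa (skip σ)) = skip (pick Qa (Selection-resp-↭ π σ))
  Selection-resp-↭ (swap x y π) (pick Qa (pick Qb σ)) =
    subst₂ (Selection _ _) (exchange _ _ _) (exchange _ _ _) (pick Qb (pick Qa (Selection-resp-↭ π σ)))
    where
    exchange : ∀ a b c → b +ₚ (a +ₚ c) ≡ a +ₚ (b +ₚ c)
    exchange = solve 3 (λ a b c → b :+ (a :+ c) := a :+ (b :+ c)) refl
  Selection-resp-↭ (_↭_.trans π π′) σ = Selection-resp-↭ π′ (Selection-resp-↭ π σ)

  select-none : ∀ xs → Selection xs 0 0# 0#
  select-none []       = []
  select-none (x ∷ xs) = skip (select-none xs)

  select : ∀ n xs → n ≤ length xs → ∃₂ (Selection xs n)
  select zero    xs       _           = 0# , 0# , select-none xs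
  select (suc n) (x ∷ xs) (s≤s n≤∣xs∣) with s , t , σ ← select n xs n≤∣xs∣ =
    1# +ₚ s , 1# *ₚ x +ₚ t , pick Q-1 σ

  -- All weights are 1. For n = p, both sums become multiples of p, which gives `select-p-equal`.
  select-constant : ∀ {m n} u xs → n ≤ m → Selection (replicate m u ++ xs) n [ n ] ([ n ] *ₚ u)
  select-constant {m} u xs z≤n = subst (Selection (replicate m u ++ xs) 0 0#) (sym (*ₚ-zeroˡ u)) (select-none _)
  select-constant {_} {suc n} u xs (s≤s n≤m) = subst₂ (Selection _ _) (sym ([]-+ 1 n))
    (trans (sym (*ₚ-distribʳ-+ₚ u 1# [ n ])) (cong (_*ₚ u) (sym ([]-+ 1 n))))
    (pick Q-1 (select-constant u xs n≤m))

  select-p-equal : ∀ {m} u xs → p ≤ m → Selection (replicate m u ++ xs) p 0# 0#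
  select-p-equal u xs p≤m = subst₂ (Selection _ p) [p]≡0 (trans (cong (_*ₚ u) [p]≡0) (*ₚ-zeroˡ u))
    (select-constant u xs p≤m)
    where
    [p]≡0 : [ p ] ≡ 0#
    [p]≡0 = p∣⇒[]≡0 ∣-refl

  -- With every bᵢ equal to b, the second condition is b times the sum of the weights.
  selection⇒weighted : ∀ b {xs n s t} → Selection xs n s t →
    ∃₂ λ (ys as : Vec (Fin p) n) → toList ys ⊆ xs × Vec.All (Q p) as
      × dotₚ p as ys ≡ t × dotₚ p (Vec.replicate n b) as ≡ b *ₚ s
  selection⇒weighted b [] = [] , [] , [] , [] , refl , sym (*ₚ-zeroʳ b)
  selection⇒weighted b (skip σ) with ys , as , ys⊆xs , Qas , eq , eq′ ← selection⇒weighted b σ =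
    ys , as , _ ∷ʳ ys⊆xs , Qas , eq , eq′
  selection⇒weighted b (pick {x} {s = s} {a = a} Qa σ) with ys , as , ys⊆xs , Qas , refl , eq ← selection⇒weighted b σ =
    x ∷ ys , a ∷ as , refl ∷ ys⊆xs , Qa ∷ Qas , refl ,
    trans (cong (b *ₚ a +ₚ_) eq) (solve 3 (λ b a s → b :* a :+ b :* s := b :* (a :+ s)) refl b a s)

  selection⇒subsequence : ∀ {B b} → b ∈ˢ B → ∀ {xs} → Selection xs p 0# 0# →
    ∃[ ys ] toList {n = p} ys ⊆ xs × WeightedZeroSum p B ys
  selection⇒subsequence {B} {b} b∈B σ with ys , as , ys⊆xs , Qas , eq , eq′ ← selection⇒weighted b σ =
    ys , ys⊆xs , as , Vec.replicate p b , Qas , all-b p , eq , trans eq′ (*ₚ-zeroʳ b)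
    where
    all-b : ∀ n → Vec.All (_∈ˢ B) (Vec.replicate n b)
    all-b zero    = []
    all-b (suc n) = b∈B ∷ all-b n

  -- The lower bound

  module _ {r} (r≢0 : r ≢ 0#) (¬Qr : ¬ Q p r) where

    obstruction : List (Fin p)
    obstruction = 1# ∷ -ₚ r ∷ replicate (ℕ.pred p) 0#

    dot-zeros : ∀ {m n} (as ys : Vec (Fin p) m) → toList ys ⊆ replicate n 0# → dotₚ p as ys ≡ 0#
    dot-zeros [] [] _ = refl
    dot-zeros {n = suc n} as@(_ ∷ _) ys@(_ ∷ _) (_ ∷ʳ ys⊆) = dot-zeros as ys ys⊆
    dot-zeros {n = suc n} (a ∷ as) (_ ∷ ys) (refl ∷ ys⊆) =
      trans (cong₂ _+ₚ_ (*ₚ-zeroʳ a) (dot-zeros as ys ys⊆)) (+ₚ-identityʳ 0#)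

    term≢0 : ∀ {a x d} → Q p a → x ≢ 0# → d ≡ 0# → a *ₚ x +ₚ d ≢ 0#
    term≢0 Qa x≢0 refl eq = *ₚ-≢0 (Q⇒≢0 Qa) x≢0 (trans (sym (+ₚ-identityʳ _)) eq)

    -- With exactly one of 1 and -r chosen, a single product is nonzero. With both chosen, a - b r =
    -- 0 would make r = a/b a residue.
    dot-obstruction≢0 : ∀ {m n} (as ys : Vec (Fin p) m) → n < m →
      toList ys ⊆ 1# ∷ -ₚ r ∷ replicate n 0# → Vec.All (Q p) as → dotₚ p as ys ≢ 0#
    dot-obstruction≢0 [] [] ()
    -- If both are skipped, m terms would have to come from n < m zeros.
    dot-obstruction≢0 {n = n} _ ys@(_ ∷ _) n<m (_ ∷ʳ _ ∷ʳ ys⊆) _ _ =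
      ℕ.<⇒≱ n<m (subst₂ _≤_ (length-toList ys) (List.length-replicate n) (length-mono-≤ ys⊆))
    dot-obstruction≢0 (a ∷ as) (_ ∷ ys) _ (_ ∷ʳ refl ∷ ys⊆) (Qa ∷ _) =
      term≢0 Qa (-ₚ-≢0 r≢0) (dot-zeros as ys ys⊆)
    dot-obstruction≢0 (a ∷ []) (_ ∷ []) _ (refl ∷ _) (Qa ∷ _) =
      term≢0 Qa 1≢0 refl
    dot-obstruction≢0 (a ∷ b ∷ as) (_ ∷ y ∷ ys) _ (refl ∷ _ ∷ʳ ys⊆) (Qa ∷ _) =
      term≢0 Qa 1≢0 (dot-zeros (b ∷ as) (y ∷ ys) ys⊆)
    dot-obstruction≢0 (a ∷ b ∷ as) (_ ∷ _ ∷ ys) _ (refl ∷ refl ∷ ys⊆) (Qa ∷ Qb ∷ _) eq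
      -- Here q = a/b, and adding r b to the vanishing sum leaves q b = r b.
      with q , Qq , refl ← Q-quotient Qb Qa = ¬Qr (subst (Q p) (*ₚ-cancelʳ b (Q⇒≢0 Qb) (begin
        q *ₚ b                                        ≡⟨ +ₚ-identityʳ _ ⟨
        q *ₚ b +ₚ 0#                                  ≡⟨ cong (q *ₚ b +ₚ_) (trans (cong (b *ₚ_) (-ₚ-inverse r)) (*ₚ-zeroʳ b)) ⟨
        q *ₚ b +ₚ b *ₚ (-ₚ r +ₚ r)                    ≡⟨ solve 4 (λ q b n r → q :* b :+ b :* (n :+ r) := q :* b :* con 1 :+ (b :* n :+ con 0) :+ r :* b) refl q b (-ₚ r) r ⟩
        q *ₚ b *ₚ 1# +ₚ (b *ₚ -ₚ r +ₚ 0#) +ₚ r *ₚ b   ≡⟨ cong (λ z → q *ₚ b *ₚ 1# +ₚ (b *ₚ -ₚ r +ₚ z) +ₚ r *ₚ b) (dot-zeros as ys ys⊆) ⟨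
        dotₚ p (q *ₚ b ∷ b ∷ as) (1# ∷ -ₚ r ∷ ys) +ₚ r *ₚ b   ≡⟨ cong (_+ₚ r *ₚ b) eq ⟩
        0# +ₚ r *ₚ b                                  ≡⟨ +ₚ-identityˡ _ ⟩
        r *ₚ b                                        ∎)) Qq)
      where open ≡-Reasoning

-- If k ≤ p + 1, the first k terms of `obstruction` form a sequence of length k, and a subsequence
-- of it is a subsequence of `obstruction`.
lower-bound : ∀ (p : ℕ) .{{_ : NonZero p}} → Prime p → 2 ∤ p → ∀ B k →
  EverySequenceHasZeroSumSubsequence p B k → p + 2 ≤ k
lower-bound p p-prime p-odd B k has = ℕ.≮⇒≥ impossible
  where
  open OddPrimeField p p-prime p-odd
  open Selections p p-prime

  impossible : ¬ k < p + 2
  impossible k<p+2 with r , r≢0 , ¬Qr ← nonresidue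
    with xs , xs⊆ ← prefix k (obstruction r≢0 ¬Qr) (subst (k ≤_)
           (cong suc (sym (trans (cong suc (List.length-replicate (ℕ.pred p))) (ℕ.suc-pred p))))
           (ℕ.<⇒≤pred (subst (k <_) (ℕ.+-comm p 2) k<p+2)))
    with ys , ys⊆xs , as , _ , Qas , _ , as·ys≡0 , _ ← has xs =
    dot-obstruction≢0 r≢0 ¬Qr as ys (ℕ.≤-reflexive (ℕ.suc-pred p)) (⊆-trans ys⊆xs xs⊆) Qas as·ys≡0

-- The upper bound for p ≥ 7

module LargePrimeSelections (p : ℕ) .{{_ : NonZero p}} (p-prime : Prime p) (p-odd : 2 ∤ p) (7≤p : 7 ≤ p) where

  open LargePrimeField p p-prime p-odd 7≤p
  open Selections p p-prime

  -- The weights of the yᵢ make Σ aᵢ (xᵢ - u) vanish, those of the three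
  -- terms u do not contribute to it and make Σ aᵢ vanish.
  select-triple : ∀ {u y₁ y₂ y₃} n zs → n ≤ length zs → y₁ ≢ u → y₂ ≢ u → y₃ ≢ u →
    Selection (u ∷ u ∷ u ∷ y₁ ∷ y₂ ∷ y₃ ∷ zs) (6 + n) 0# 0#
  select-triple {u} {y₁} {y₂} {y₃} n zs n≤∣zs∣ y₁≢u y₂≢u y₃≢u
    with S , T , σ ← select n zs n≤∣zs∣
    with d₁ , refl ← difference u y₁ | d₂ , refl ← difference u y₂ | d₃ , refl ← difference u y₃
    -- The terms chosen from `zs` contribute e = T - u S to Σ aᵢ (xᵢ - u).
    with e , refl ← difference (u *ₚ S) T
    with b₁ , b₂ , b₃ , Qb₁ , Qb₂ , Qb₃ , b·d≡-e ← ternary-form-universal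
           (≢⇒difference≢0 refl y₁≢u) (≢⇒difference≢0 refl y₂≢u) (≢⇒difference≢0 refl y₃≢u) (-ₚ e)
    with a₁ , a₂ , a₃ , Qa₁ , Qa₂ , Qa₃ , Σa≡ ← ternary-form-universal 1≢0 1≢0 1≢0 (-ₚ (b₁ +ₚ b₂ +ₚ b₃ +ₚ S)) =
    subst₂ (Selection _ _) Σ≡0 dot≡0
      (pick Qa₁ (pick Qa₂ (pick Qa₃ (pick Qb₁ (pick Qb₂ (pick Qb₃ σ))))))
    where
    open ≡-Reasoning

    total : Fin p
    total = a₁ *ₚ 1# +ₚ a₂ *ₚ 1# +ₚ a₃ *ₚ 1# +ₚ (b₁ +ₚ b₂ +ₚ b₃ +ₚ S)

    total≡0 : total ≡ 0#
    total≡0 = trans (cong (_+ₚ (b₁ +ₚ b₂ +ₚ b₃ +ₚ S)) Σa≡) (-ₚ-inverse _)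

    form≡0 : b₁ *ₚ d₁ +ₚ b₂ *ₚ d₂ +ₚ b₃ *ₚ d₃ +ₚ e ≡ 0#
    form≡0 = trans (cong (_+ₚ e) b·d≡-e) (-ₚ-inverse e)

    Σ≡0 : a₁ +ₚ (a₂ +ₚ (a₃ +ₚ (b₁ +ₚ (b₂ +ₚ (b₃ +ₚ S))))) ≡ 0#
    Σ≡0 = trans (solve 7 (λ a₁ a₂ a₃ b₁ b₂ b₃ S →
        a₁ :+ (a₂ :+ (a₃ :+ (b₁ :+ (b₂ :+ (b₃ :+ S))))) :=
        a₁ :* con 1 :+ a₂ :* con 1 :+ a₃ :* con 1 :+ (b₁ :+ b₂ :+ b₃ :+ S)) refl a₁ a₂ a₃ b₁ b₂ b₃ S)
      total≡0

    dot≡0 : a₁ *ₚ u +ₚ (a₂ *ₚ u +ₚ (a₃ *ₚ u +ₚ (b₁ *ₚ (u +ₚ d₁) +ₚ (b₂ *ₚ (u +ₚ d₂) +ₚ (b₃ *ₚ (u +ₚ d₃) +ₚ (u *ₚ S +ₚ e)))))) ≡ 0#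
    dot≡0 = begin
      a₁ *ₚ u +ₚ (a₂ *ₚ u +ₚ (a₃ *ₚ u +ₚ (b₁ *ₚ (u +ₚ d₁) +ₚ (b₂ *ₚ (u +ₚ d₂) +ₚ (b₃ *ₚ (u +ₚ d₃) +ₚ (u *ₚ S +ₚ e))))))
        ≡⟨ solve 12 (λ u a₁ a₂ a₃ b₁ b₂ b₃ d₁ d₂ d₃ S e →
             a₁ :* u :+ (a₂ :* u :+ (a₃ :* u :+ (b₁ :* (u :+ d₁) :+ (b₂ :* (u :+ d₂) :+ (b₃ :* (u :+ d₃) :+ (u :* S :+ e)))))) :=
             u :* (a₁ :* con 1 :+ a₂ :* con 1 :+ a₃ :* con 1 :+ (b₁ :+ b₂ :+ b₃ :+ S)) :+ (b₁ :* d₁ :+ b₂ :* d₂ :+ b₃ :* d₃ :+ e))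
             refl u a₁ a₂ a₃ b₁ b₂ b₃ d₁ d₂ d₃ S e ⟩
      u *ₚ total +ₚ (b₁ *ₚ d₁ +ₚ b₂ *ₚ d₂ +ₚ b₃ *ₚ d₃ +ₚ e)
        ≡⟨ cong₂ (λ k l → u *ₚ k +ₚ l) total≡0 form≡0 ⟩
      u *ₚ 0# +ₚ 0#
        ≡⟨ trans (+ₚ-identityʳ _) (*ₚ-zeroʳ u) ⟩
      0# ∎

  -- Here u = v + δ and w = u + ω, and the other terms have total weight S and
  -- weighted sum u S + e: the equations are Σ aᵢ (xᵢ - v) = 0 and Σ aᵢ = 0.
  TwoPairWeights : (δ ω S e : Fin p) → Set
  TwoPairWeights δ ω S e =
    ∃[ a₁ ] ∃[ a₂ ] ∃[ b₁ ] ∃[ b₂ ] ∃[ c ] Q p a₁ × Q p a₂ × Q p b₁ × Q p b₂ × Q p c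
      × (a₁ +ₚ a₂) *ₚ δ +ₚ (c *ₚ (δ +ₚ ω) +ₚ (δ *ₚ S +ₚ e)) ≡ 0#
      × b₁ +ₚ b₂ +ₚ (a₁ +ₚ a₂ +ₚ c +ₚ S) ≡ 0#

  -- Once c is fixed, the first equation determines s = a₁ + a₂, and the second requires b₁ + b₂ =
  -- -(s + c + S). The two values that c avoids are those for which one of these sums would be 0;
  -- otherwise both are sums of two residues.
  two-pair-weights : ∀ {δ ω} → δ ≢ 0# → ω ≢ 0# → δ +ₚ ω ≢ 0# → ∀ S e → TwoPairWeights δ ω S e
  two-pair-weights {δ} {ω} δ≢0 ω≢0 δ+ω≢0 S e
    with c , Qc , c[δ+ω]≢ , cω≢ ← avoiding δ+ω≢0 ω≢0 (-ₚ (δ *ₚ S +ₚ e)) (-ₚ e) =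
    weights c Qc c[δ+ω]≢ cω≢
    where
    open ≡-Reasoning

    weights : ∀ c → Q p c → c *ₚ (δ +ₚ ω) ≢ -ₚ (δ *ₚ S +ₚ e) → c *ₚ ω ≢ -ₚ e → TwoPairWeights δ ω S e
    weights c Qc c[δ+ω]≢ cω≢ =
      assemble (≢0⇒sum-of-two s≢0) (≢0⇒sum-of-two (-ₚ-≢0 Y≢0))
      where
      X : Fin p
      X = c *ₚ (δ +ₚ ω) +ₚ (δ *ₚ S +ₚ e)

      s : Fin p
      s = proj₁ (quotient δ (-ₚ X) δ≢0)

      sδ≡-X : s *ₚ δ ≡ -ₚ X
      sδ≡-X = proj₂ (quotient δ (-ₚ X) δ≢0)

      form≡0 : s *ₚ δ +ₚ X ≡ 0#
      form≡0 = trans (cong (_+ₚ X) sδ≡-X) (-ₚ-inverse X)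

      s≢0 : s ≢ 0#
      s≢0 s≡0 = -ₚ-≢0 (c[δ+ω]≢ ∘ +ₚ≡0⇒≡-ₚ) (trans (sym sδ≡-X) (trans (cong (_*ₚ δ) s≡0) (*ₚ-zeroˡ δ)))

      Y≢0 : s +ₚ c +ₚ S ≢ 0#
      -- The first equation gives δ (s + c + S) = -(c ω + e).
      Y≢0 eq = cω≢ (+ₚ≡0⇒≡-ₚ (begin
        c *ₚ ω +ₚ e
          ≡⟨ +ₚ-identityˡ _ ⟨
        0# +ₚ (c *ₚ ω +ₚ e)
          ≡⟨ cong (_+ₚ (c *ₚ ω +ₚ e)) (trans (cong (δ *ₚ_) eq) (*ₚ-zeroʳ δ)) ⟨
        δ *ₚ (s +ₚ c +ₚ S) +ₚ (c *ₚ ω +ₚ e)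
          ≡⟨ solve 6 (λ δ s c S ω e →
               δ :* (s :+ c :+ S) :+ (c :* ω :+ e) :=
               s :* δ :+ (c :* (δ :+ ω) :+ (δ :* S :+ e))) refl δ s c S ω e ⟩
        s *ₚ δ +ₚ X
          ≡⟨ form≡0 ⟩
        0# ∎))

      assemble : SumOfTwo s → SumOfTwo (-ₚ (s +ₚ c +ₚ S)) → TwoPairWeights δ ω S e
      assemble (a₁ , a₂ , Qa₁ , Qa₂ , a₁+a₂≡s) (b₁ , b₂ , Qb₁ , Qb₂ , b₁+b₂≡-Y) =
        a₁ , a₂ , b₁ , b₂ , c , Qa₁ , Qa₂ , Qb₁ , Qb₂ , Qc ,
        trans (cong (λ k → k *ₚ δ +ₚ X) a₁+a₂≡s) form≡0 ,
        trans (cong₂ (λ k l → l +ₚ (k +ₚ c +ₚ S)) a₁+a₂≡s b₁+b₂≡-Y) (-ₚ-inverse (s +ₚ c +ₚ S))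

  length-remaining-≥ : ∀ k {n l} → k + n ≡ p → k + l ≡ p + 2 → n ≤ l
  length-remaining-≥ k {n} {l} refl eq = ℕ.+-cancelˡ-≤ k n l (subst (k + n ≤_) (sym eq) (ℕ.m≤m+n (k + n) 2))

  select-two-pairs-by : ∀ {v δ ω S e n zs} → TwoPairWeights δ ω S e →
    Selection zs n S ((v +ₚ δ) *ₚ S +ₚ e) →
    Selection (v +ₚ δ ∷ v +ₚ δ ∷ v ∷ v ∷ v +ₚ δ +ₚ ω ∷ zs) (5 + n) 0# 0#
  select-two-pairs-by {v} {δ} {ω} {S} {e}
    (a₁ , a₂ , b₁ , b₂ , c , Qa₁ , Qa₂ , Qb₁ , Qb₂ , Qc , form≡0 , total≡0) σ =
    subst₂ (Selection _ _) Σ≡0 dot≡0 (pick Qa₁ (pick Qa₂ (pick Qb₁ (pick Qb₂ (pick Qc σ)))))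
    where
    open ≡-Reasoning

    Σ≡0 : a₁ +ₚ (a₂ +ₚ (b₁ +ₚ (b₂ +ₚ (c +ₚ S)))) ≡ 0#
    Σ≡0 = trans (solve 6 (λ a₁ a₂ b₁ b₂ c S →
        a₁ :+ (a₂ :+ (b₁ :+ (b₂ :+ (c :+ S)))) :=
        b₁ :+ b₂ :+ (a₁ :+ a₂ :+ c :+ S)) refl a₁ a₂ b₁ b₂ c S)
      total≡0

    dot≡0 : a₁ *ₚ (v +ₚ δ) +ₚ (a₂ *ₚ (v +ₚ δ) +ₚ (b₁ *ₚ v +ₚ (b₂ *ₚ v +ₚ (c *ₚ (v +ₚ δ +ₚ ω) +ₚ ((v +ₚ δ) *ₚ S +ₚ e))))) ≡ 0#
    dot≡0 = begin
      a₁ *ₚ (v +ₚ δ) +ₚ (a₂ *ₚ (v +ₚ δ) +ₚ (b₁ *ₚ v +ₚ (b₂ *ₚ v +ₚ (c *ₚ (v +ₚ δ +ₚ ω) +ₚ ((v +ₚ δ) *ₚ S +ₚ e)))))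
        ≡⟨ solve 10 (λ v δ ω a₁ a₂ b₁ b₂ c S e →
             a₁ :* (v :+ δ) :+ (a₂ :* (v :+ δ) :+ (b₁ :* v :+ (b₂ :* v :+ (c :* (v :+ δ :+ ω) :+ ((v :+ δ) :* S :+ e))))) :=
             v :* (b₁ :+ b₂ :+ (a₁ :+ a₂ :+ c :+ S)) :+ ((a₁ :+ a₂) :* δ :+ (c :* (δ :+ ω) :+ (δ :* S :+ e))))
             refl v δ ω a₁ a₂ b₁ b₂ c S e ⟩
      v *ₚ (b₁ +ₚ b₂ +ₚ (a₁ +ₚ a₂ +ₚ c +ₚ S)) +ₚ ((a₁ +ₚ a₂) *ₚ δ +ₚ (c *ₚ (δ +ₚ ω) +ₚ (δ *ₚ S +ₚ e)))
        ≡⟨ cong₂ (λ k l → v *ₚ k +ₚ l) total≡0 form≡0 ⟩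
      v *ₚ 0# +ₚ 0#
        ≡⟨ trans (+ₚ-identityʳ _) (*ₚ-zeroʳ v) ⟩
      0# ∎

  select-two-pairs : ∀ {u v w} n zs → n ≤ length zs → u ≢ v → w ≢ u → w ≢ v →
    Selection (u ∷ u ∷ v ∷ v ∷ w ∷ zs) (5 + n) 0# 0#
  select-two-pairs {u} {v} {w} n zs n≤∣zs∣ u≢v w≢u w≢v
    with S , T , σ ← select n zs n≤∣zs∣
    with δ , refl ← difference v u
    with ω , refl ← difference (v +ₚ δ) w
    with e , refl ← difference ((v +ₚ δ) *ₚ S) T =
    select-two-pairs-by (two-pair-weights (≢⇒difference≢0 refl u≢v) (≢⇒difference≢0 refl w≢u)
      (≢⇒difference≢0 (sym (+ₚ-assoc v δ ω)) w≢v) S e) σ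

  select-all-large : ∀ xs → length xs ≡ p + 2 → Selection xs p 0# 0#
  -- With p = 7 + j, two pairs and w are 5 terms and need 2 + j more; a triple and three others are
  -- 6 terms and need 1 + j more.
  select-all-large xs ∣xs∣ with j , 7+j≡p ← ℕ.m≤n⇒∃[o]m+o≡n 7≤p | triple-or-two-pairs xs 2<p ∣xs∣
  ... | inj₂ (u , v , w , zs , xs↭ , u≢v , w≢u , w≢v) =
    subst (λ n → Selection xs n 0# 0#) 7+j≡p (Selection-resp-↭ (↭-sym xs↭)
      (select-two-pairs (2 + j) zs (length-remaining-≥ 5 7+j≡p (trans (sym (↭-length xs↭)) ∣xs∣)) u≢v w≢u w≢v))
  ... | inj₁ (u , zs , xs↭) with gather u zs
  ...   | m , ys , zs↭ , ys≢u =
    by-others ys ys≢u (↭-trans xs↭ (prep u (prep u (prep u zs↭))))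
    where
    -- At most 2 of the p + 2 terms differ from u, so at least p are equal to u.
    few : ∀ {ys} → length ys ≤ 2 → xs ↭ replicate (3 + m) u ++ ys → Selection xs p 0# 0#
    few {ys} ∣ys∣≤2 π = Selection-resp-↭ (↭-sym π) (select-p-equal u ys (ℕ.+-cancelʳ-≤ 2 p (3 + m) (begin
      p + 2                                    ≡⟨ ∣xs∣ ⟨
      length xs                                ≡⟨ ↭-length π ⟩
      length (replicate (3 + m) u ++ ys)       ≡⟨ List.length-++ (replicate (3 + m) u) ⟩
      length (replicate (3 + m) u) + length ys ≡⟨ cong (_+ length ys) (List.length-replicate (3 + m)) ⟩
      3 + m + length ys                        ≤⟨ ℕ.+-monoʳ-≤ (3 + m) ∣ys∣≤2 ⟩
      3 + m + 2                                ∎)))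
      where open ℕ.≤-Reasoning

    by-others : ∀ ys → List.All (_≢ u) ys → xs ↭ replicate (3 + m) u ++ ys → Selection xs p 0# 0#
    by-others []           _ π = few z≤n π
    by-others (_ ∷ [])     _ π = few (s≤s z≤n) π
    by-others (_ ∷ _ ∷ []) _ π = few (s≤s (s≤s z≤n)) π
    by-others (y₁ ∷ y₂ ∷ y₃ ∷ ys) (y₁≢u ∷ y₂≢u ∷ y₃≢u ∷ _) π =
      subst (λ n → Selection xs n 0# 0#) 7+j≡p (Selection-resp-↭ (↭-sym π′)
        (select-triple (1 + j) rest (length-remaining-≥ 6 7+j≡p (trans (sym (↭-length π′)) ∣xs∣)) y₁≢u y₂≢u y₃≢u))
      where
      -- Further copies of u join the terms with arbitrary weights.
      rest : List (Fin p)
      rest = replicate m u ++ ys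

      π′ : xs ↭ u ∷ u ∷ u ∷ y₁ ∷ y₂ ∷ y₃ ∷ rest
      π′ = ↭-trans π (prep u (prep u (prep u (shifts (replicate m u) (y₁ ∷ y₂ ∷ y₃ ∷ [])))))

-- The upper bound for p = 3

module SelectionsModulo3 (3-prime : Prime 3) (3-odd : 2 ∤ 3) where

  open OddPrimeField 3 3-prime 3-odd
  open Selections 3 3-prime

  -- Three distinct residues modulo 3 are 0, 1, 2 in some order; the finitely many cases are decided
  -- by computation.
  distinct⇒sum≡0 : ∀ u v w → u ≢ v → w ≢ u → w ≢ v → 1# *ₚ u +ₚ (1# *ₚ v +ₚ (1# *ₚ w +ₚ 0#)) ≡ 0#
  distinct⇒sum≡0 = from-yes (all? λ u → all? λ v → all? λ w →
    ¬? (u ≟ v) →-dec ¬? (w ≟ u) →-dec ¬? (w ≟ v) →-dec (1# *ₚ u +ₚ (1# *ₚ v +ₚ (1# *ₚ w +ₚ 0#)) ≟ 0#))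

  select-all-3 : ∀ xs → length xs ≡ 5 → Selection xs 3 0# 0#
  select-all-3 xs ∣xs∣ with triple-or-two-pairs xs 2<p ∣xs∣
  ... | inj₁ (u , zs , xs↭) = Selection-resp-↭ (↭-sym xs↭) (select-p-equal {3} u zs ℕ.≤-refl)
  ... | inj₂ (u , v , w , zs , xs↭ , u≢v , w≢u , w≢v) = Selection-resp-↭ (↭-sym xs↭)
    -- The sum 1 + 1 + 1 of the weights computes to 0; only the weighted sum is rewritten.
    (subst (Selection _ 3 0#) (distinct⇒sum≡0 u v w u≢v w≢u w≢v)
      (pick Q-1 (skip (pick Q-1 (skip (pick Q-1 (select-none zs)))))))

-- Case distinction on p and the exact value

odd-prime≢5 : ∀ {p} → Prime p → 2 ∤ p → p ≢ 5 → p ≡ 3 ⊎ 7 ≤ p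
odd-prime≢5 {0} p-prime _ _ = contradiction p-prime ¬prime[0]
odd-prime≢5 {1} p-prime _ _ = contradiction p-prime ¬prime[1]
odd-prime≢5 {2} _ p-odd _ = contradiction (divides 1 refl) p-odd
odd-prime≢5 {3} _ _ _ = inj₁ refl
odd-prime≢5 {4} _ p-odd _ = contradiction (divides 2 refl) p-odd
odd-prime≢5 {5} _ _ p≢5 = contradiction refl p≢5
odd-prime≢5 {6} _ p-odd _ = contradiction (divides 3 refl) p-odd
odd-prime≢5 {suc (suc (suc (suc (suc (suc (suc p))))))} _ _ _ = inj₂ (ℕ.m≤m+n 7 p)

upper-bound : ∀ (p : ℕ) .{{_ : NonZero p}} (p-prime : Prime p) → 2 ∤ p → p ≢ 5 →
  ∀ xs → length xs ≡ p + 2 → Selections.Selection p p-prime xs p (0ₚ p) (0ₚ p)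
upper-bound p p-prime p-odd p≢5 with odd-prime≢5 p-prime p-odd p≢5
... | inj₁ refl = SelectionsModulo3.select-all-3 p-prime p-odd
... | inj₂ 7≤p  = LargePrimeSelections.select-all-large p p-prime p-odd 7≤p

theorem5p1 : (p : ℕ) .{{_ : NonZero p}} → Prime p → 2 ∤ p → p ≢ 5 →
    (B : Subset p) → Nonempty B → E≡ p B (p + 2)
theorem5p1 p p-prime p-odd p≢5 B (b , b∈B) =
  ℕ.<-≤-trans z<s (ℕ.m≤n+m 2 p) ,
  (λ xs → Selections.selection⇒subsequence p p-prime b∈B
    (upper-bound p p-prime p-odd p≢5 (toList xs) (length-toList xs))) ,
  λ k _ → lower-bound p p-prime p-odd B k
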